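{- For every integer $m\geq 1$, let \[F_m(q)=1+\sum_{k=1}^{m-1}(-1)^k\prod_{i=0}^{k-1}\left(\frac{1}{q^{m-1-i}}-1\right).\] Then, as formal Laurent series in $q$, \[\sum_{n=1}^{\infty}a_m(n)q^n=\frac{F_m(q)}{(q;q)_\infty}-\mathcal{D}_m,\] where $\mathcal{D}_m$ is the sum of the terms with exponent of $q$ less than or equal to $0$ in the Laurent expansion of $F_m(q)/(q;q)_\infty$.
   Context: $a_m(n)$ is the number of partitions of $n$ in which the smallest part occurs at least $m$ times. $(a;q)_\infty=\prod_{i\geq 0}(1-aq^i)$, so $1/(q;q)_\infty=\sum_{n\geq0}p(n)q^n$ with $p(n)$ the number of partitions of $n$. Empty sums are $0$ and empty products are $1$. -}

module Defs where

open import Data.Bool.Base using (if_then_else_)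
open import Data.Integer.Base as ℤ using (ℤ; +_; -[1+_]; 0ℤ; 1ℤ; -1ℤ)
open import Data.List.Base using (List; []; _∷_; applyUpTo; cartesianProductWith; filter; foldr; length; replicate)
open import Data.List.Membership.Propositional using (_∈_)
open import Data.List.Membership.Propositional.Properties
  using (∈-applyUpTo⁺; ∈-cartesianProductWith⁺; ∈-cartesianProductWith⁻; ∈-filter⁺; ∈-filter⁻)
open import Data.List.Properties using (∷-injective)
open import Data.List.Relation.Unary.All as All using (All; []; _∷_)
open import Data.List.Relation.Unary.AllPairs using ([]; _∷_)
open import Data.List.Relation.Unary.Any as Any using (Any; here; there)
open import Data.List.Relation.Unary.Linked as Linked using (Linked)
open import Data.List.Relation.Unary.Unique.Propositional using (Unique)
open import Data.List.Relation.Unary.Unique.Propositional.Properties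
  using (applyUpTo⁺₁; cartesianProductWith⁺; filter⁺)
open import Data.Nat.Base using (ℕ; zero; suc; _+_; _∸_; _≤_; _≥_; _≤ᵇ_; z≤n; s≤s)
open import Data.Nat.ListAction using (sum)
open import Data.Nat.Properties
  using (_≟_; _≤?_; _≥?_; ≤-refl; ≤-reflexive; ≤-trans; +-mono-≤; m≤m+n; m≤n+m; <⇒≢; suc-injective)
open import Data.Product.Base using (_×_; _,_; proj₂)
open import Function.Base using (_∘_)
open import Relation.Binary.PropositionalEquality using (_≡_; _≢_; refl; sym; subst)
open import Relation.Nullary.Decidable using (Dec; _×-dec_)

IsPartition : ℕ → List ℕ → Set
IsPartition n xs = Linked _≥_ xs × All (1 ≤_) xs × sum xs ≡ n

isPartition? : ∀ n xs → Dec (IsPartition n xs)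
isPartition? n xs =
  Linked.linked? _≥?_ xs ×-dec All.all? (1 ≤?_) xs ×-dec (sum xs ≟ n)

-- All lists of length at most l with entries in {1, …, b}.
boundedLists : (l b : ℕ) → List (List ℕ)
boundedLists zero    b = [] ∷ []
boundedLists (suc l) b =
  [] ∷ cartesianProductWith _∷_ (applyUpTo suc b) (boundedLists l b)

-- A partition of n has at most n parts, each at most n; see
-- ∈-partitions⁺, ∈-partitions⁻ and partitions-unique below.
partitions : ℕ → List (List ℕ)
partitions n = filter (isPartition? n) (boundedLists n n)

multiplicity : ℕ → List ℕ → ℕ
multiplicity s = length ∘ filter (s ≟_)

-- Some part s is the smallest one and occurs at least m times (so the
-- empty partition never qualifies).
SmallestPartOccurs≥ : ℕ → List ℕ → Set
SmallestPartOccurs≥ m xs =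
  Any (λ s → All (s ≤_) xs × m ≤ multiplicity s xs) xs

smallestPartOccurs≥? : ∀ m xs → Dec (SmallestPartOccurs≥ m xs)
smallestPartOccurs≥? m xs =
  Any.any? (λ s → All.all? (s ≤?_) xs ×-dec (m ≤? multiplicity s xs)) xs

a : ℕ → ℕ → ℕ
a m n = length (filter (smallestPartOccurs≥? m) (partitions n))

∈-boundedLists⁺ : ∀ {l b xs} → length xs ≤ l → All (1 ≤_) xs → All (_≤ b) xs →
                  xs ∈ boundedLists l b
∈-boundedLists⁺ {zero}  {xs = []}         _       _          _          = here refl
∈-boundedLists⁺ {suc l} {xs = []}         _       _          _          = here refl
∈-boundedLists⁺ {suc l} {xs = suc x ∷ xs} (s≤s p) (_ ∷ pos) (x≤b ∷ bd) =
  there (∈-cartesianProductWith⁺ _∷_ (∈-applyUpTo⁺ suc x≤b) (∈-boundedLists⁺ p pos bd))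

boundedLists-unique : ∀ l b → Unique (boundedLists l b)
boundedLists-unique zero    b = [] ∷ []
boundedLists-unique (suc l) b =
  All.tabulate []≢ ∷
  cartesianProductWith⁺ _∷_ ∷-injective
    (applyUpTo⁺₁ suc b λ i<j _ → <⇒≢ i<j ∘ suc-injective)
    (boundedLists-unique l b)
  where
  []≢ : ∀ {ys} → ys ∈ cartesianProductWith _∷_ (applyUpTo suc b) (boundedLists l b) → [] ≢ ys
  []≢ ys∈ refl
    with _ , _ , _ , _ , () ← ∈-cartesianProductWith⁻ _∷_ (applyUpTo suc b) (boundedLists l b) ys∈

length≤sum : ∀ {xs} → All (1 ≤_) xs → length xs ≤ sum xs
length≤sum []        = z≤n
length≤sum (p ∷ pos) = +-mono-≤ p (length≤sum pos)

parts≤sum : ∀ xs → All (_≤ sum xs) xs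
parts≤sum []       = []
parts≤sum (x ∷ xs) =
  m≤m+n x (sum xs) ∷ All.map (λ y≤ → ≤-trans y≤ (m≤n+m (sum xs) x)) (parts≤sum xs)

∈-partitions⁺ : ∀ {n xs} → IsPartition n xs → xs ∈ partitions n
∈-partitions⁺ {xs = xs} isP@(_ , pos , refl) =
  ∈-filter⁺ (isPartition? (sum xs)) (∈-boundedLists⁺ (length≤sum pos) pos (parts≤sum xs)) isP

∈-partitions⁻ : ∀ {n xs} → xs ∈ partitions n → IsPartition n xs
∈-partitions⁻ {n} xs∈ = proj₂ (∈-filter⁻ (isPartition? n) {xs = boundedLists n n} xs∈)

partitions-unique : ∀ n → Unique (partitions n)
partitions-unique n = filter⁺ (isPartition? n) (boundedLists-unique n n)

PowerSeries : Set
PowerSeries = ℕ → ℤ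

infixl 6 _+ˢ_ _-ˢ_
infixl 7 _*ˢ_
infixl 8 _·q^_

0ˢ 1ˢ qˢ : PowerSeries
0ˢ _ = 0ℤ

1ˢ zero    = 1ℤ
1ˢ (suc _) = 0ℤ

_+ˢ_ _-ˢ_ _*ˢ_ : PowerSeries → PowerSeries → PowerSeries
(f +ˢ g) n = f n ℤ.+ g n
(f -ˢ g) n = f n ℤ.- g n
(f *ˢ g) n = foldr ℤ._+_ 0ℤ (applyUpTo (λ i → f i ℤ.* g (n ∸ i)) (suc n))

_·q^_ : PowerSeries → ℕ → PowerSeries
(f ·q^ zero)  n       = f n
(f ·q^ suc s) zero    = 0ℤ
(f ·q^ suc s) (suc n) = (f ·q^ s) n

qˢ = 1ˢ ·q^ 1

sumˢ productˢ : List PowerSeries → PowerSeries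
sumˢ     = foldr _+ˢ_ 0ˢ
productˢ = foldr _*ˢ_ 1ˢ

-- pochhammer∞ f is (f;q)_∞ = ∏_{i≥0} (1 - f qⁱ).  The factors with i > n are 1 + O(qⁿ⁺¹), so
-- the coefficient of qⁿ is that of the product over 0 ≤ i ≤ n.
pochhammer∞ : PowerSeries → PowerSeries
pochhammer∞ f n = productˢ (applyUpTo (λ i → 1ˢ -ˢ f ·q^ i) (suc n)) n

-- 1/f = Σ_{j≥0} (1 - f)ʲ for f with constant term 1.  Since (1 - f)ʲ = O(qʲ),
-- only j ≤ n contributes to the coefficient of qⁿ.
recip : (f : PowerSeries) → .(f 0 ≡ 1ℤ) → PowerSeries
recip f _ n = sumˢ (applyUpTo (λ j → productˢ (replicate j (1ˢ -ˢ f))) (suc n)) n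

infixl 6 _+ᴸ_ _-ᴸ_
infixl 7 _*ᴸ_
infix  9 _/q^_
infix  4 _≈_

-- f /q^ s is the Laurent series q⁻ˢ f(q).  Different pairs may denote the same
-- Laurent series; equality is _≈_ below.
record Laurent : Set where
  constructor _/q^_
  field
    numerator : PowerSeries
    pole      : ℕ

open Laurent public

coeff : Laurent → ℤ → ℤ
coeff (f /q^ s) e with e ℤ.+ + s
... | + n      = f n
... | -[1+ _ ] = 0ℤ

_≈_ : Laurent → Laurent → Set
x ≈ y = ∀ e → coeff x e ≡ coeff y e

fromPowerSeries : PowerSeries → Laurent
fromPowerSeries f = f /q^ 0

0ᴸ 1ᴸ : Laurent
0ᴸ = fromPowerSeries 0ˢ
1ᴸ = fromPowerSeries 1ˢ

constᴸ : ℤ → Laurent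
constᴸ c = fromPowerSeries (λ n → c ℤ.* 1ˢ n)

_+ᴸ_ _-ᴸ_ _*ᴸ_ : Laurent → Laurent → Laurent
(f /q^ s) +ᴸ (g /q^ t) = (f ·q^ t +ˢ g ·q^ s) /q^ (s + t)
(f /q^ s) -ᴸ (g /q^ t) = (f ·q^ t -ˢ g ·q^ s) /q^ (s + t)
(f /q^ s) *ᴸ (g /q^ t) = (f *ˢ g) /q^ (s + t)

sumᴸ productᴸ : List Laurent → Laurent
sumᴸ     = foldr _+ᴸ_ 0ᴸ
productᴸ = foldr _*ᴸ_ 1ᴸ

-- The sum of the terms with exponent ≤ 0; the n-th coefficient of the
-- numerator belongs to the exponent n - s.
nonPositivePart : Laurent → Laurent
nonPositivePart (f /q^ s) = (λ n → if n ≤ᵇ s then f n else 0ℤ) /q^ s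

-- The summation index is k = suc k′ with k′ < m - 1.  In every factor
-- i < k ≤ m - 1, so the exponent m - 1 - i is not truncated.
F : ℕ → Laurent
F m = 1ᴸ +ᴸ sumᴸ (applyUpTo (λ k′ → term (suc k′)) (m ∸ 1))
  where
  term : ℕ → Laurent
  term k = constᴸ (-1ℤ ℤ.^ k) *ᴸ
           productᴸ (applyUpTo (λ i → 1ˢ /q^ (m ∸ 1 ∸ i) -ᴸ 1ᴸ) k)

1/qq∞ : Laurent
1/qq∞ = fromPowerSeries (recip (pochhammer∞ qˢ) refl)

𝒟 : ℕ → Laurent
𝒟 m = nonPositivePart (F m *ᴸ 1/qq∞)

∑a : ℕ → PowerSeries
∑a m zero    = 0ℤ
∑a m (suc n) = + a m (suc n)

{-# OPTIONS --safe #-}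
module Submission where

open import Defs
open import Algebra.Core using (Op₂)
open import Data.Bool.Base using (true; false; if_then_else_)
open import Data.Bool.Properties using (T-≡)
open import Data.Integer.Base as ℤ using (ℤ; +_; -[1+_]; 0ℤ; 1ℤ; -1ℤ)
import Data.Integer.Properties as ℤₚ
open import Data.Integer.Tactic.RingSolver using (solve-∀)
open import Data.List.Base
  using (List; []; _∷_; _∷ʳ_; _++_; [_]; applyUpTo; filter; length; map; replicate)
open import Data.List.Membership.Propositional using (_∈_; find)
open import Data.List.Membership.Propositional.Properties
  using (∈-filter⁺; ∈-filter⁻; ∈-map⁺; ∈-map⁻)
open import Data.List.Membership.Propositional.Properties.WithK using (unique∧set⇒bag)
open import Data.List.Properties
  using (filter-none; filter-some; filter-++; filter-accept; length-++; length-map; ∷ʳ-injectiveˡ)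
open import Data.List.Relation.Binary.BagAndSetEquality using (∼bag⇒↭)
open import Data.List.Relation.Binary.Permutation.Propositional.Properties using (↭-length)
open import Data.List.Relation.Unary.All as All using (All; []; _∷_)
open import Data.List.Relation.Unary.All.Properties as Allₚ using (¬Any⇒All¬)
open import Data.List.Relation.Unary.Any as Any using (Any; here; there)
open import Data.List.Relation.Unary.Linked using (Linked; []; [-]; _∷_)
open import Data.List.Relation.Unary.Unique.Propositional using (Unique)
import Data.List.Relation.Unary.Unique.Propositional.Properties as Uniqueₚ
open import Data.Nat.Base
  using (ℕ; zero; suc; _+_; _*_; _∸_; _≤_; _<_; _≥_; _≤ᵇ_; z≤n; s≤s)
open import Data.Nat.ListAction using (sum)
open import Data.Nat.ListAction.Properties using (sum-++)
open import Data.Nat.Properties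
import Data.Nat.Tactic.RingSolver as ℕ-Solver
open import Data.Product.Base using (_×_; _,_; proj₁; proj₂; ∃)
open import Data.Sum.Base using (_⊎_; inj₁; inj₂)
open import Function.Base using (_∘_)
open import Function.Bundles using (Equivalence; mk⇔)
open import Level using (Level)
open import Relation.Binary.PropositionalEquality hiding ([_])
open import Relation.Nullary.Decidable using (Dec; yes; no; _×-dec_)
open import Relation.Nullary.Negation using (¬_; contradiction)
open import Relation.Unary using (Pred; Decidable)
open ≡-Reasoning

-- The polynomials satisfy F_{m+1} = 1 - (q⁻ᵐ - 1) F_m, so it suffices that, for n ≥ 1,
-- a_m(m + n) + a_{m+1}(n) = p(n) + a_m(n), together with a_1(n) = p(n).  Bijectively: from a
-- partition of m + n whose smallest part s occurs at least m times, either delete m ones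
-- (s = 1), or lower m copies of s to s - 1, which gives a partition of n whose smallest part
-- occurs exactly m times.  In terms of P_s, the series of the partitions with all parts ≥ s,
-- the partitions with smallest part s occurring at least m times have series q^{ms} P_s, and
-- the identity follows from P_s = P_{s+1} + qˢ P_s by summation over s.  The same recurrence
-- gives (1 - q) ⋯ (1 - qᴺ) P_1 = P_{N+1} = 1 + O(q^{N+1}), hence P_1 = 1/(q;q)_∞.

-- Power series

infix 4 _≐_ _≐[_]_

_≐_ : PowerSeries → PowerSeries → Set
f ≐ g = ∀ n → f n ≡ g n

_≐[_]_ : PowerSeries → ℕ → PowerSeries → Set
f ≐[ n ] g = ∀ i → i ≤ n → f i ≡ g i

-- The bounded version serves truncations: a finite product agrees with `pochhammer∞` only up to a
-- given degree, and a remainder vanishes only below its order.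
*ˢ-cong-≤ : ∀ n {f f′ g g′} → f ≐[ n ] f′ → g ≐[ n ] g′ → (f *ˢ g) n ≡ (f′ *ˢ g′) n
*ˢ-cong-≤ zero    p q = cong₂ (λ x y → x ℤ.* y ℤ.+ 0ℤ) (p 0 z≤n) (q 0 z≤n)
*ˢ-cong-≤ (suc n) p q = cong₂ ℤ._+_
  (cong₂ ℤ._*_ (p 0 z≤n) (q (suc n) ≤-refl))
  (*ˢ-cong-≤ n (λ i i≤n → p (suc i) (s≤s i≤n)) (λ i i≤n → q i (m≤n⇒m≤1+n i≤n)))

*ˢ-cong : ∀ {f f′ g g′} → f ≐ f′ → g ≐ g′ → f *ˢ g ≐ f′ *ˢ g′
*ˢ-cong p q n = *ˢ-cong-≤ n (λ i _ → p i) (λ i _ → q i)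

*ˢ-congˡ : ∀ f {g g′} → g ≐ g′ → f *ˢ g ≐ f *ˢ g′
*ˢ-congˡ f = *ˢ-cong {f} (λ _ → refl)

*ˢ-congʳ : ∀ {f f′} g → f ≐ f′ → f *ˢ g ≐ f′ *ˢ g
*ˢ-congʳ g p = *ˢ-cong {g = g} p (λ _ → refl)

*ˢ-zeroˡ : ∀ f → 0ˢ *ˢ f ≐ 0ˢ
*ˢ-zeroˡ f zero    = refl
*ˢ-zeroˡ f (suc n) = trans (ℤₚ.+-identityˡ _) (*ˢ-zeroˡ f n)

*ˢ-zeroʳ : ∀ f → f *ˢ 0ˢ ≐ 0ˢ
*ˢ-zeroʳ f zero    = trans (ℤₚ.+-identityʳ _) (ℤₚ.*-zeroʳ (f 0))
*ˢ-zeroʳ f (suc n) = cong₂ ℤ._+_ (ℤₚ.*-zeroʳ (f 0)) (*ˢ-zeroʳ (f ∘ suc) n)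

*ˢ-identityˡ : ∀ f → 1ˢ *ˢ f ≐ f
*ˢ-identityˡ f zero    = trans (ℤₚ.+-identityʳ _) (ℤₚ.*-identityˡ _)
*ˢ-identityˡ f (suc n) = begin
  1ℤ ℤ.* f (suc n) ℤ.+ (0ˢ *ˢ f) n ≡⟨ cong₂ ℤ._+_ (ℤₚ.*-identityˡ (f (suc n))) (*ˢ-zeroˡ f n) ⟩
  f (suc n) ℤ.+ 0ℤ                 ≡⟨ ℤₚ.+-identityʳ _ ⟩
  f (suc n)                        ∎

*ˢ-assoc-scalar : ∀ c f g → (λ n → c ℤ.* f n) *ˢ g ≐ λ n → c ℤ.* (f *ˢ g) n
*ˢ-assoc-scalar c f g zero = lemma c (f 0) (g 0)
  where
  lemma : ∀ c x y → c ℤ.* x ℤ.* y ℤ.+ 0ℤ ≡ c ℤ.* (x ℤ.* y ℤ.+ 0ℤ)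
  lemma = solve-∀
*ˢ-assoc-scalar c f g (suc n) =
  trans (cong (λ z → c ℤ.* f 0 ℤ.* g (suc n) ℤ.+ z) (*ˢ-assoc-scalar c (f ∘ suc) g n))
        (lemma c (f 0) (g (suc n)) _)
  where
  lemma : ∀ c x y z → c ℤ.* x ℤ.* y ℤ.+ c ℤ.* z ≡ c ℤ.* (x ℤ.* y ℤ.+ z)
  lemma = solve-∀

-- One proof of distributivity covers sums and differences: `interchange` carries the operation
-- through the sum that defines a coefficient, and `zero∙` splits the 0 at the end of that sum.
module _ (_∙_ : Op₂ ℤ)
         (interchange : ∀ x y z w → (x ∙ y) ℤ.+ (z ∙ w) ≡ (x ℤ.+ z) ∙ (y ℤ.+ w))
         (zero∙ : 0ℤ ∙ 0ℤ ≡ 0ℤ) where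

  private
    _∙ˢ_ : PowerSeries → PowerSeries → PowerSeries
    (f ∙ˢ g) n = f n ∙ g n

  *ˢ-distribˡ : (∀ x y z → x ℤ.* (y ∙ z) ≡ (x ℤ.* y) ∙ (x ℤ.* z)) →
                ∀ f g h → f *ˢ (g ∙ˢ h) ≐ (f *ˢ g) ∙ˢ (f *ˢ h)
  *ˢ-distribˡ distrib f g h zero =
    trans (cong₂ ℤ._+_ (distrib (f 0) (g 0) (h 0)) (sym zero∙)) (interchange _ _ _ _)
  *ˢ-distribˡ distrib f g h (suc n) =
    trans (cong₂ ℤ._+_ (distrib (f 0) (g (suc n)) (h (suc n)))
      (*ˢ-distribˡ distrib (f ∘ suc) g h n))
          (interchange _ _ _ _)

  *ˢ-distribʳ : (∀ x y z → (y ∙ z) ℤ.* x ≡ (y ℤ.* x) ∙ (z ℤ.* x)) →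
                ∀ h f g → (f ∙ˢ g) *ˢ h ≐ (f *ˢ h) ∙ˢ (g *ˢ h)
  *ˢ-distribʳ distrib h f g zero =
    trans (cong₂ ℤ._+_ (distrib (h 0) (f 0) (g 0)) (sym zero∙)) (interchange _ _ _ _)
  *ˢ-distribʳ distrib h f g (suc n) =
    trans (cong₂ ℤ._+_ (distrib (h (suc n)) (f 0) (g 0))
      (*ˢ-distribʳ distrib h (f ∘ suc) (g ∘ suc) n))
          (interchange _ _ _ _)

+-interchange : ∀ x y z w → (x ℤ.+ y) ℤ.+ (z ℤ.+ w) ≡ (x ℤ.+ z) ℤ.+ (y ℤ.+ w)
+-interchange = solve-∀

+-−-interchange : ∀ x y z w → (x ℤ.- y) ℤ.+ (z ℤ.- w) ≡ (x ℤ.+ z) ℤ.- (y ℤ.+ w)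
+-−-interchange = solve-∀

*-distribˡ-− : ∀ x y z → x ℤ.* (y ℤ.- z) ≡ x ℤ.* y ℤ.- x ℤ.* z
*-distribˡ-− = solve-∀

*-distribʳ-− : ∀ x y z → (y ℤ.- z) ℤ.* x ≡ y ℤ.* x ℤ.- z ℤ.* x
*-distribʳ-− = solve-∀

*ˢ-distribˡ-+ˢ : ∀ f g h → f *ˢ (g +ˢ h) ≐ f *ˢ g +ˢ f *ˢ h
*ˢ-distribˡ-+ˢ = *ˢ-distribˡ ℤ._+_ +-interchange refl ℤₚ.*-distribˡ-+

*ˢ-distribʳ-+ˢ : ∀ h f g → (f +ˢ g) *ˢ h ≐ f *ˢ h +ˢ g *ˢ h
*ˢ-distribʳ-+ˢ = *ˢ-distribʳ ℤ._+_ +-interchange refl ℤₚ.*-distribʳ-+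

*ˢ-distribˡ--ˢ : ∀ f g h → f *ˢ (g -ˢ h) ≐ f *ˢ g -ˢ f *ˢ h
*ˢ-distribˡ--ˢ = *ˢ-distribˡ ℤ._-_ +-−-interchange refl *-distribˡ-−

*ˢ-distribʳ--ˢ : ∀ h f g → (f -ˢ g) *ˢ h ≐ f *ˢ h -ˢ g *ˢ h
*ˢ-distribʳ--ˢ = *ˢ-distribʳ ℤ._-_ +-−-interchange refl *-distribʳ-−

-- Multiplication by powers of q

·q^-cong-≤ : ∀ s n {f g} → f ≐[ n ] g → (f ·q^ s) n ≡ (g ·q^ s) n
·q^-cong-≤ zero    n       p = p n ≤-refl
·q^-cong-≤ (suc s) zero    p = refl
·q^-cong-≤ (suc s) (suc n) p = ·q^-cong-≤ s n (λ i i≤n → p i (m≤n⇒m≤1+n i≤n))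

·q^-cong : ∀ s {f g} → f ≐ g → f ·q^ s ≐ g ·q^ s
·q^-cong s p n = ·q^-cong-≤ s n (λ i _ → p i)

·q^-·q^ : ∀ f s t → (f ·q^ s) ·q^ t ≐ f ·q^ (t + s)
·q^-·q^ f s zero    n       = refl
·q^-·q^ f s (suc t) zero    = refl
·q^-·q^ f s (suc t) (suc n) = ·q^-·q^ f s t n

·q^-+ˢ : ∀ f g s → (f +ˢ g) ·q^ s ≐ f ·q^ s +ˢ g ·q^ s
·q^-+ˢ f g zero    n       = refl
·q^-+ˢ f g (suc s) zero    = refl
·q^-+ˢ f g (suc s) (suc n) = ·q^-+ˢ f g s n

·q^-coeff : ∀ f s n → (f ·q^ s) (s + n) ≡ f n
·q^-coeff f zero    n = refl
·q^-coeff f (suc s) n = ·q^-coeff f s n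

·q^-coeff-< : ∀ f {s n} → n < s → (f ·q^ s) n ≡ 0ℤ
·q^-coeff-< f {suc s} {zero}  _       = refl
·q^-coeff-< f {suc s} {suc n} (s≤s p) = ·q^-coeff-< f p

-- `_*ˢ_` unfolds at `f 0`; splitting off the other end exposes the constant term of a shifted
-- second factor.
*ˢ-suc : ∀ f g n → (f *ˢ g) (suc n) ≡ (f *ˢ (g ∘ suc)) n ℤ.+ f (suc n) ℤ.* g 0
*ˢ-suc f g zero    = lemma (f 0 ℤ.* g 1) (f 1 ℤ.* g 0)
  where
  lemma : ∀ x y → x ℤ.+ (y ℤ.+ 0ℤ) ≡ (x ℤ.+ 0ℤ) ℤ.+ y
  lemma = solve-∀
*ˢ-suc f g (suc n) =
  trans (cong (λ z → f 0 ℤ.* g (suc (suc n)) ℤ.+ z) (*ˢ-suc (f ∘ suc) g n))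
    (sym (ℤₚ.+-assoc (f 0 ℤ.* g (suc (suc n))) _ _))

*ˢ-·q^ : ∀ s f g → f *ˢ (g ·q^ s) ≐ (f *ˢ g) ·q^ s
*ˢ-·q^ zero    f g n       = refl
*ˢ-·q^ (suc s) f g zero    = trans (ℤₚ.+-identityʳ _) (ℤₚ.*-zeroʳ (f 0))
*ˢ-·q^ (suc s) f g (suc n) = begin
  (f *ˢ (g ·q^ suc s)) (suc n)                ≡⟨ *ˢ-suc f (g ·q^ suc s) n ⟩
  (f *ˢ (g ·q^ s)) n ℤ.+ f (suc n) ℤ.* 0ℤ
    ≡⟨ cong₂ ℤ._+_ (*ˢ-·q^ s f g n) (ℤₚ.*-zeroʳ (f (suc n))) ⟩
  ((f *ˢ g) ·q^ s) n ℤ.+ 0ℤ                   ≡⟨ ℤₚ.+-identityʳ _ ⟩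
  ((f *ˢ g) ·q^ s) n                          ∎

·q^-*ˢ : ∀ s f g → (f ·q^ s) *ˢ g ≐ (f *ˢ g) ·q^ s
·q^-*ˢ zero    f g n       = refl
·q^-*ˢ (suc s) f g zero    = refl
·q^-*ˢ (suc s) f g (suc n) = trans (ℤₚ.+-identityˡ _) (·q^-*ˢ s f g n)

-- Reciprocals

-- Geometric series: with u = 1 - f the hypothesis reads g = 1 + u g, and N iterations give g = 1 +
-- u + ... + u^(N-1) + u^N g. The last term has order at least N, so the partial sum with N = n + 1,
-- which defines `recip`, is right at n.
recip-unique : ∀ f (f₀ : f 0 ≡ 1ℤ) g → f *ˢ g ≐ 1ˢ → recip f f₀ ≐ g
recip-unique f f₀ g fg≐1 n = sym (begin
  g n                             ≡⟨ expand (suc n) n ⟩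
  S (suc n) n ℤ.+ T (suc n) n     ≡⟨ cong (λ z → S (suc n) n ℤ.+ z) (T-order (suc n) n ≤-refl) ⟩
  S (suc n) n ℤ.+ 0ℤ              ≡⟨ ℤₚ.+-identityʳ _ ⟩
  S (suc n) n                     ∎)
  where
  u = 1ˢ -ˢ f
  S T : ℕ → PowerSeries
  S N = sumˢ (applyUpTo (λ j → productˢ (replicate j u)) N)
  T zero    = g
  T (suc N) = u *ˢ T N
  g≐1+ug : g ≐ 1ˢ +ˢ u *ˢ g
  g≐1+ug i = sym (begin
    1ˢ i ℤ.+ (u *ˢ g) i                       ≡⟨ cong (λ z → 1ˢ i ℤ.+ z) (*ˢ-distribʳ--ˢ g 1ˢ f i) ⟩
    1ˢ i ℤ.+ ((1ˢ *ˢ g) i ℤ.- (f *ˢ g) i)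
      ≡⟨ cong₂ (λ x y → 1ˢ i ℤ.+ (x ℤ.- y)) (*ˢ-identityˡ g i) (fg≐1 i) ⟩
    1ˢ i ℤ.+ (g i ℤ.- 1ˢ i)                   ≡⟨ lemma (1ˢ i) (g i) ⟩
    g i                                       ∎)
    where
    lemma : ∀ x y → x ℤ.+ (y ℤ.- x) ≡ y
    lemma = solve-∀
  u*S : ∀ (h : ℕ → PowerSeries) N → u *ˢ sumˢ (applyUpTo h N) ≐ sumˢ (applyUpTo (λ j → u *ˢ h j) N)
  u*S h zero    i = *ˢ-zeroʳ u i
  u*S h (suc N) i = trans (*ˢ-distribˡ-+ˢ u (h 0) (sumˢ (applyUpTo (h ∘ suc) N)) i)
    (cong (λ z → (u *ˢ h 0) i ℤ.+ z) (u*S (h ∘ suc) N i))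
  expand : ∀ N → g ≐ S N +ˢ T N
  expand zero    i = sym (ℤₚ.+-identityˡ (g i))
  expand (suc N) i = begin
    g i                                             ≡⟨ g≐1+ug i ⟩
    1ˢ i ℤ.+ (u *ˢ g) i
      ≡⟨ cong (λ z → 1ˢ i ℤ.+ z) (*ˢ-congˡ u (expand N) i) ⟩
    1ˢ i ℤ.+ (u *ˢ (S N +ˢ T N)) i
      ≡⟨ cong (λ z → 1ˢ i ℤ.+ z) (*ˢ-distribˡ-+ˢ u (S N) (T N) i) ⟩
    1ˢ i ℤ.+ ((u *ˢ S N) i ℤ.+ T (suc N) i)         ≡⟨ ℤₚ.+-assoc (1ˢ i) _ _ ⟨
    (1ˢ i ℤ.+ (u *ˢ S N) i) ℤ.+ T (suc N) i
      ≡⟨ cong (λ x → 1ˢ i ℤ.+ x ℤ.+ T (suc N) i) (u*S _ N i) ⟩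
    S (suc N) i ℤ.+ T (suc N) i                     ∎
  -- Each factor u raises the order by one, since its constant term 1 - `f 0` is 0; the other
  -- summands involve `T N` only in degrees at most i, where induction applies.
  T-order : ∀ N i → i < N → T N i ≡ 0ℤ
  T-order (suc N) zero    _         =
    trans (ℤₚ.+-identityʳ _) (cong (λ x → (1ℤ ℤ.- x) ℤ.* T N 0) f₀)
  T-order (suc N) (suc i) (s≤s i<N) = cong₂ ℤ._+_
    (cong (λ x → (1ℤ ℤ.- x) ℤ.* T N (suc i)) f₀)
    (trans (*ˢ-cong-≤ i {u ∘ suc} {u ∘ suc} {T N} {0ˢ} (λ _ _ → refl)
      (λ j j≤i → T-order N j (≤-<-trans j≤i i<N)))
           (*ˢ-zeroʳ (u ∘ suc) i))

-- Finite q-products and the reciprocal of (q;q)_∞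

-- The finite product (q^s;q)_N; a variable s lets inductions split off the first factor.
qFactors : ℕ → ℕ → PowerSeries
qFactors s N = productˢ (applyUpTo (λ i → 1ˢ -ˢ 1ˢ ·q^ (i + s)) N)

1-q^s-*ˢ : ∀ s f → (1ˢ -ˢ 1ˢ ·q^ s) *ˢ f ≐ f -ˢ f ·q^ s
1-q^s-*ˢ s f n = begin
  ((1ˢ -ˢ 1ˢ ·q^ s) *ˢ f) n                ≡⟨ *ˢ-distribʳ--ˢ f 1ˢ (1ˢ ·q^ s) n ⟩
  (1ˢ *ˢ f) n ℤ.- ((1ˢ ·q^ s) *ˢ f) n      ≡⟨ cong₂ ℤ._-_ (*ˢ-identityˡ f n)
                                               (trans (·q^-*ˢ s 1ˢ f n)
                                                      (·q^-cong s (*ˢ-identityˡ f) n)) ⟩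
  f n ℤ.- (f ·q^ s) n                      ∎

productˢ-cong : ∀ {f g : ℕ → PowerSeries} N → (∀ i → f i ≐ g i) →
                productˢ (applyUpTo f N) ≐ productˢ (applyUpTo g N)
productˢ-cong zero    f≐g n = refl
productˢ-cong (suc N) f≐g = *ˢ-cong (f≐g 0) (productˢ-cong N (f≐g ∘ suc))

qFactors-suc : ∀ s N → qFactors s (suc N) ≐ qFactors (suc s) N -ˢ qFactors (suc s) N ·q^ s
qFactors-suc s N n =
  trans (*ˢ-congˡ (1ˢ -ˢ 1ˢ ·q^ s) (productˢ-cong N λ i j →
    cong (λ e → 1ˢ j ℤ.- (1ˢ ·q^ e) j) (sym (+-suc i s))) n)
        (1-q^s-*ˢ s (qFactors (suc s) N) n)

-- The extra factor 1 - q^(s+N) changes nothing below degree s + N. The induction splits off the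
-- first factor instead, which raises s, lowers N and so keeps the bound.
qFactors-stable : ∀ s N n → n < s + N → qFactors s (suc N) n ≡ qFactors s N n
qFactors-stable s zero n n<s = begin
  qFactors s 1 n                      ≡⟨ qFactors-suc s 0 n ⟩
  1ˢ n ℤ.- (1ˢ ·q^ s) n
    ≡⟨ cong (λ x → 1ˢ n ℤ.- x) (·q^-coeff-< 1ˢ (subst (n <_) (+-identityʳ s) n<s)) ⟩
  1ˢ n ℤ.- 0ℤ                         ≡⟨ ℤₚ.+-identityʳ _ ⟩
  1ˢ n                                ∎
qFactors-stable s (suc N) n n<s+1+N = begin
  qFactors s (suc (suc N)) n
    ≡⟨ qFactors-suc s (suc N) n ⟩
  (qFactors (suc s) (suc N) -ˢ qFactors (suc s) (suc N) ·q^ s) n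
    ≡⟨ cong₂ ℤ._-_ (ih n ≤-refl) (·q^-cong-≤ s n ih) ⟩
  (qFactors (suc s) N -ˢ qFactors (suc s) N ·q^ s) n                    ≡⟨ qFactors-suc s N n ⟨
  qFactors s (suc N) n                                                  ∎
  where
  ih : qFactors (suc s) (suc N) ≐[ n ] qFactors (suc s) N
  ih i i≤n = qFactors-stable (suc s) N i (subst (i <_) (+-suc s N) (≤-<-trans i≤n n<s+1+N))

qFactors-stable* : ∀ s d N n → n < s + N → qFactors s (d + N) n ≡ qFactors s N n
qFactors-stable* s zero    N n n<s+N = refl
qFactors-stable* s (suc d) N n n<s+N = trans
  (qFactors-stable s (d + N) n (<-≤-trans n<s+N (+-monoʳ-≤ s (m≤n+m N d))))
  (qFactors-stable* s d N n n<s+N)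

-- The coefficients of the infinite product come from finite products of varying length; a
-- convolution up to n needs one product for all of them.
pochhammer∞-coeff : ∀ n i → i ≤ n → pochhammer∞ qˢ i ≡ qFactors 1 (suc n) i
pochhammer∞-coeff n i i≤n = begin
  pochhammer∞ qˢ i
    ≡⟨ productˢ-cong (suc i) (λ k j → cong (λ x → 1ˢ j ℤ.- x) (·q^-·q^ 1ˢ 1 k j)) i ⟩
  qFactors 1 (suc i) i                ≡⟨ qFactors-stable* 1 (n ∸ i) (suc i) i (m≤n+m (suc i) 1) ⟨
  qFactors 1 (n ∸ i + suc i) i
    ≡⟨ cong (λ N → qFactors 1 N i) (trans (+-suc (n ∸ i) i) (cong suc (m∸n+n≡m i≤n))) ⟩
  qFactors 1 (suc n) i                ∎

-- The recurrence says (1 - q^s) P_s = P_(s+1), so a finite q-product moves along the family. It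
-- starts at s = 1, since at s = 0 it would force P_1 = 0.
module _ (P : ℕ → PowerSeries)
         (P-suc : ∀ s n → P (suc s) n ≡ P (suc (suc s)) n ℤ.+ (P (suc s) ·q^ suc s) n) where

  qFactors-*ˢ : ∀ s N → qFactors (suc s) N *ˢ P (suc s) ≐ P (suc s + N)
  qFactors-*ˢ s zero    n = trans (*ˢ-identityˡ (P (suc s)) n)
    (cong (λ k → P (suc k) n) (sym (+-identityʳ s)))
  qFactors-*ˢ s (suc N) n = begin
    (qFactors (suc s) (suc N) *ˢ P (suc s)) n
      ≡⟨ *ˢ-congʳ (P (suc s)) (qFactors-suc (suc s) N) n ⟩
    ((R -ˢ R ·q^ suc s) *ˢ P (suc s)) n            ≡⟨ *ˢ-distribʳ--ˢ (P (suc s)) R (R ·q^ suc s) n ⟩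
    (R *ˢ P (suc s)) n ℤ.- ((R ·q^ suc s) *ˢ P (suc s)) n
      -- The power of q moves from `R` to `P (suc s)`, where the recurrence absorbs it.
      ≡⟨ cong (λ x → (R *ˢ P (suc s)) n ℤ.- x)
         (trans (·q^-*ˢ (suc s) R (P (suc s)) n) (sym (*ˢ-·q^ (suc s) R (P (suc s)) n))) ⟩
    (R *ˢ P (suc s)) n ℤ.- (R *ˢ (P (suc s) ·q^ suc s)) n
      ≡⟨ *ˢ-distribˡ--ˢ R (P (suc s)) (P (suc s) ·q^ suc s) n ⟨
    (R *ˢ (P (suc s) -ˢ P (suc s) ·q^ suc s)) n    ≡⟨ *ˢ-congˡ R difference n ⟩
    (R *ˢ P (suc (suc s))) n                       ≡⟨ qFactors-*ˢ (suc s) N n ⟩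
    P (suc (suc s) + N) n                          ≡⟨ cong (λ k → P (suc k) n) (sym (+-suc s N)) ⟩
    P (suc s + suc N) n                            ∎
    where
    R = qFactors (suc (suc s)) N
    lemma : ∀ x y → (x ℤ.+ y) ℤ.- y ≡ x
    lemma = solve-∀
    difference : P (suc s) -ˢ P (suc s) ·q^ suc s ≐ P (suc (suc s))
    difference i = trans (cong (λ x → x ℤ.- (P (suc s) ·q^ suc s) i) (P-suc s i))
                         (lemma (P (suc (suc s)) i) _)

  module _ (P-order : ∀ s n → n < s → P s n ≡ 1ˢ n) where

    -- At n, the product of n + 1 factors leads from P_1 to P_(n+2), which agrees with 1 up to
    -- degree n + 1.
    1/pochhammer∞ : recip (pochhammer∞ qˢ) refl ≐ P 1
    1/pochhammer∞ = recip-unique (pochhammer∞ qˢ) refl (P 1) λ n → begin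
      (pochhammer∞ qˢ *ˢ P 1) n
        ≡⟨ *ˢ-cong-≤ n {g = P 1} (pochhammer∞-coeff n) (λ _ _ → refl) ⟩
      (qFactors 1 (suc n) *ˢ P 1) n     ≡⟨ qFactors-*ˢ 0 (suc n) n ⟩
      P (suc (suc n)) n                 ≡⟨ P-order (suc (suc n)) n (m≤n+m (suc n) 1) ⟩
      1ˢ n                              ∎

-- Laurent series

-- The case distinction of `coeff` as a function of the shifted exponent, so that this exponent can
-- be rewritten by equations.
extend : PowerSeries → ℤ → ℤ
extend f (+ n)    = f n
extend f -[1+ _ ] = 0ℤ

coeff-extend : ∀ f s e → coeff (f /q^ s) e ≡ extend f (e ℤ.+ + s)
coeff-extend f s e with e ℤ.+ + s
... | + _      = refl
... | -[1+ _ ] = refl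

extend-cong : ∀ {f g} → f ≐ g → ∀ e → extend f e ≡ extend g e
extend-cong f≐g (+ n)    = f≐g n
extend-cong f≐g -[1+ _ ] = refl

coeff-cong : ∀ {f g} s → f ≐ g → f /q^ s ≈ g /q^ s
coeff-cong {f} {g} s f≐g e = begin
  coeff (f /q^ s) e     ≡⟨ coeff-extend f s e ⟩
  extend f (e ℤ.+ + s)  ≡⟨ extend-cong f≐g (e ℤ.+ + s) ⟩
  extend g (e ℤ.+ + s)  ≡⟨ coeff-extend g s e ⟨
  coeff (g /q^ s) e     ∎

extend-+ˢ : ∀ f g e → extend (f +ˢ g) e ≡ extend f e ℤ.+ extend g e
extend-+ˢ f g (+ n)    = refl
extend-+ˢ f g -[1+ _ ] = refl

extend--ˢ : ∀ f g e → extend (f -ˢ g) e ≡ extend f e ℤ.- extend g e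
extend--ˢ f g (+ n)    = refl
extend--ˢ f g -[1+ _ ] = refl

coeff-+ˢ : ∀ f g s e → coeff ((f +ˢ g) /q^ s) e ≡ coeff (f /q^ s) e ℤ.+ coeff (g /q^ s) e
coeff-+ˢ f g s e = begin
  coeff ((f +ˢ g) /q^ s) e                            ≡⟨ coeff-extend (f +ˢ g) s e ⟩
  extend (f +ˢ g) (e ℤ.+ + s)                         ≡⟨ extend-+ˢ f g (e ℤ.+ + s) ⟩
  extend f (e ℤ.+ + s) ℤ.+ extend g (e ℤ.+ + s)
    ≡⟨ cong₂ ℤ._+_ (coeff-extend f s e) (coeff-extend g s e) ⟨
  coeff (f /q^ s) e ℤ.+ coeff (g /q^ s) e             ∎

coeff--ˢ : ∀ f g s e → coeff ((f -ˢ g) /q^ s) e ≡ coeff (f /q^ s) e ℤ.- coeff (g /q^ s) e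
coeff--ˢ f g s e = begin
  coeff ((f -ˢ g) /q^ s) e                            ≡⟨ coeff-extend (f -ˢ g) s e ⟩
  extend (f -ˢ g) (e ℤ.+ + s)                         ≡⟨ extend--ˢ f g (e ℤ.+ + s) ⟩
  extend f (e ℤ.+ + s) ℤ.- extend g (e ℤ.+ + s)
    ≡⟨ cong₂ ℤ._-_ (coeff-extend f s e) (coeff-extend g s e) ⟨
  coeff (f /q^ s) e ℤ.- coeff (g /q^ s) e             ∎

coeff-scalar : ∀ c f s e → coeff ((λ n → c ℤ.* f n) /q^ s) e ≡ c ℤ.* coeff (f /q^ s) e
coeff-scalar c f s e with e ℤ.+ + s
... | + _      = refl
... | -[1+ _ ] = sym (ℤₚ.*-zeroʳ c)

extend-·q^ : ∀ f t e → extend (f ·q^ t) (e ℤ.+ + t) ≡ extend f e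
extend-·q^ f zero    e = cong (extend f) (ℤₚ.+-identityʳ e)
extend-·q^ f (suc t) e = trans (cong (extend (f ·q^ suc t)) (lemma e (+ t)))
  (trans (step (e ℤ.+ + t)) (extend-·q^ f t e))
  where
  lemma : ∀ x y → x ℤ.+ (1ℤ ℤ.+ y) ≡ (x ℤ.+ y) ℤ.+ 1ℤ
  lemma = solve-∀
  step : ∀ e → extend (f ·q^ suc t) (e ℤ.+ 1ℤ) ≡ extend (f ·q^ t) e
  step (+ n)          = cong (f ·q^ suc t) (+-comm n 1)
  step -[1+ zero ]    = refl
  step -[1+ suc _ ]   = refl

-- Here q^t cancels against q^(-t). The pole is a variable `r` with an equation, so that sums of
-- poles match in any order.
coeff-·q^ : ∀ f s t {r} → r ≡ s + t → (f ·q^ t) /q^ r ≈ f /q^ s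
coeff-·q^ f s t refl e = begin
  coeff ((f ·q^ t) /q^ (s + t)) e              ≡⟨ coeff-extend (f ·q^ t) (s + t) e ⟩
  extend (f ·q^ t) (e ℤ.+ (+ s ℤ.+ + t))
    ≡⟨ cong (extend (f ·q^ t)) (ℤₚ.+-assoc e (+ s) (+ t)) ⟨
  extend (f ·q^ t) (e ℤ.+ + s ℤ.+ + t)         ≡⟨ extend-·q^ f t (e ℤ.+ + s) ⟩
  extend f (e ℤ.+ + s)                         ≡⟨ coeff-extend f s e ⟨
  coeff (f /q^ s) e                            ∎

-- Raising only the pole multiplies by q^(-t), which moves exponent e + t to e.
coeff-/q^ : ∀ f s t {r} → r ≡ t + s → ∀ e → coeff (f /q^ r) e ≡ coeff (f /q^ s) (e ℤ.+ + t)
coeff-/q^ f s t refl e = begin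
  coeff (f /q^ (t + s)) e              ≡⟨ coeff-extend f (t + s) e ⟩
  extend f (e ℤ.+ (+ t ℤ.+ + s))       ≡⟨ cong (extend f) (ℤₚ.+-assoc e (+ t) (+ s)) ⟨
  extend f (e ℤ.+ + t ℤ.+ + s)         ≡⟨ coeff-extend f s (e ℤ.+ + t) ⟨
  coeff (f /q^ s) (e ℤ.+ + t)          ∎

coeff--ᴸ : ∀ x y e → coeff (x -ᴸ y) e ≡ coeff x e ℤ.- coeff y e
coeff--ᴸ (f /q^ s) (g /q^ t) e = trans (coeff--ˢ (f ·q^ t) (g ·q^ s) (s + t) e)
  (cong₂ ℤ._-_ (coeff-·q^ f s t refl e) (coeff-·q^ g t s (+-comm s t) e))

coeff-+ᴸ-*ᴸ : ∀ x y z e → coeff ((x +ᴸ y) *ᴸ z) e ≡ coeff (x *ᴸ z) e ℤ.+ coeff (y *ᴸ z) e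
coeff-+ᴸ-*ᴸ (f /q^ s) (g /q^ t) (h /q^ u) e = begin
  coeff (((f ·q^ t +ˢ g ·q^ s) *ˢ h) /q^ (s + t + u)) e
    ≡⟨ coeff-cong (s + t + u) (λ n → trans (*ˢ-distribʳ-+ˢ h (f ·q^ t) (g ·q^ s) n)
       (cong₂ ℤ._+_ (·q^-*ˢ t f h n) (·q^-*ˢ s g h n))) e ⟩
  coeff (((f *ˢ h) ·q^ t +ˢ (g *ˢ h) ·q^ s) /q^ (s + t + u)) e
    ≡⟨ coeff-+ˢ ((f *ˢ h) ·q^ t) ((g *ˢ h) ·q^ s) (s + t + u) e ⟩
  coeff (((f *ˢ h) ·q^ t) /q^ (s + t + u)) e ℤ.+ coeff (((g *ˢ h) ·q^ s) /q^ (s + t + u)) e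
    ≡⟨ cong₂ ℤ._+_ (coeff-·q^ (f *ˢ h) (s + u) t (lemma₁ s t u) e)
       (coeff-·q^ (g *ˢ h) (t + u) s (lemma₂ s t u) e) ⟩
  coeff ((f *ˢ h) /q^ (s + u)) e ℤ.+ coeff ((g *ˢ h) /q^ (t + u)) e ∎
  where
  lemma₁ : ∀ s t u → s + t + u ≡ s + u + t
  lemma₁ = ℕ-Solver.solve-∀
  lemma₂ : ∀ s t u → s + t + u ≡ t + u + s
  lemma₂ = ℕ-Solver.solve-∀

coeff-constᴸ : ∀ c x z e → coeff ((constᴸ c *ᴸ x) *ᴸ z) e ≡ c ℤ.* coeff (x *ᴸ z) e
coeff-constᴸ c (f /q^ s) (h /q^ u) e = trans
  (coeff-cong (s + u) (λ n → trans (*ˢ-congʳ h scale n) (*ˢ-assoc-scalar c f h n)) e)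
  (coeff-scalar c (f *ˢ h) (s + u) e)
  where
  scale : (λ n → c ℤ.* 1ˢ n) *ˢ f ≐ λ n → c ℤ.* f n
  scale n = trans (*ˢ-assoc-scalar c 1ˢ f n) (cong (c ℤ.*_) (*ˢ-identityˡ f n))

coeff-1/q^-1 : ∀ t x z e → coeff (((1ˢ /q^ t -ᴸ 1ᴸ) *ᴸ x) *ᴸ z) e ≡
               coeff (x *ᴸ z) (e ℤ.+ + t) ℤ.- coeff (x *ᴸ z) e
coeff-1/q^-1 t (f /q^ s) (h /q^ u) e = begin
  coeff (((1ˢ -ˢ 1ˢ ·q^ t) *ˢ f *ˢ h) /q^ (t + 0 + s + u)) e
    ≡⟨ coeff-cong (t + 0 + s + u) numer e ⟩
  coeff ((f *ˢ h -ˢ (f *ˢ h) ·q^ t) /q^ (t + 0 + s + u)) e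
    ≡⟨ coeff--ˢ (f *ˢ h) ((f *ˢ h) ·q^ t) (t + 0 + s + u) e ⟩
  coeff ((f *ˢ h) /q^ (t + 0 + s + u)) e ℤ.- coeff (((f *ˢ h) ·q^ t) /q^ (t + 0 + s + u)) e
    ≡⟨ cong₂ ℤ._-_ (coeff-/q^ (f *ˢ h) (s + u) t (lemma₁ t s u) e)
       (coeff-·q^ (f *ˢ h) (s + u) t (lemma₂ t s u) e) ⟩
  coeff ((f *ˢ h) /q^ (s + u)) (e ℤ.+ + t) ℤ.- coeff ((f *ˢ h) /q^ (s + u)) e ∎
  where
  lemma₁ : ∀ t s u → t + 0 + s + u ≡ t + (s + u)
  lemma₁ = ℕ-Solver.solve-∀
  lemma₂ : ∀ t s u → t + 0 + s + u ≡ s + u + t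
  lemma₂ = ℕ-Solver.solve-∀
  numer : (1ˢ -ˢ 1ˢ ·q^ t) *ˢ f *ˢ h ≐ f *ˢ h -ˢ (f *ˢ h) ·q^ t
  numer n = begin
    ((1ˢ -ˢ 1ˢ ·q^ t) *ˢ f *ˢ h) n            ≡⟨ *ˢ-congʳ h (1-q^s-*ˢ t f) n ⟩
    ((f -ˢ f ·q^ t) *ˢ h) n                   ≡⟨ *ˢ-distribʳ--ˢ h f (f ·q^ t) n ⟩
    (f *ˢ h) n ℤ.- ((f ·q^ t) *ˢ h) n         ≡⟨ cong (λ x → (f *ˢ h) n ℤ.- x) (·q^-*ˢ t f h n) ⟩
    (f *ˢ h) n ℤ.- ((f *ˢ h) ·q^ t) n         ∎

coeff-1ᴸ-*ᴸ : ∀ z → 1ᴸ *ᴸ z ≈ z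
coeff-1ᴸ-*ᴸ (h /q^ u) = coeff-cong u (*ˢ-identityˡ h)

coeff-0ᴸ-*ᴸ : ∀ z e → coeff (0ᴸ *ᴸ z) e ≡ 0ℤ
coeff-0ᴸ-*ᴸ (h /q^ u) e = trans (coeff-cong u (*ˢ-zeroˡ h) e)
  (lemma (e ℤ.+ + u) (coeff-extend 0ˢ u e))
  where
  lemma : ∀ i {x} → x ≡ extend 0ˢ i → x ≡ 0ℤ
  lemma (+ _)    p = p
  lemma -[1+ _ ] p = p

-- The recurrence for F_m

-- The summand local to `F`, with k = 0 allowed: there it is the leading 1 of F_m.
Fproduct Fterm : ℕ → ℕ → Laurent
Fproduct m k = productᴸ (applyUpTo (λ i → 1ˢ /q^ (m ∸ 1 ∸ i) -ᴸ 1ᴸ) k)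
Fterm m k = constᴸ (-1ℤ ℤ.^ k) *ᴸ Fproduct m k

-- The recurrence is phrased by coefficients of products with z, because representations of Laurent
-- series are not unique; it is applied with z = 1/(q;q)_∞.
module _ (z : Laurent) where

  private
    coeff* : Laurent → ℤ → ℤ
    coeff* x e = coeff (x *ᴸ z) e

  -- The first factor is q^(-(m+1)) - 1 and the others form the product for `suc m`; the extra sign
  -- exchanges the two terms of the difference.
  coeff-Fterm-suc : ∀ m k e → coeff* (Fterm (suc (suc m)) (suc k)) e ≡
                    coeff* (Fterm (suc m) k) e ℤ.- coeff* (Fterm (suc m) k) (e ℤ.+ + suc m)
  coeff-Fterm-suc m k e = begin
    coeff* (Fterm (suc (suc m)) (suc k)) e
      ≡⟨ coeff-constᴸ (-1ℤ ℤ.^ suc k) (Fproduct (suc (suc m)) (suc k)) z e ⟩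
    -1ℤ ℤ.^ suc k ℤ.* coeff* (Fproduct (suc (suc m)) (suc k)) e
      ≡⟨ cong (-1ℤ ℤ.^ suc k ℤ.*_) (coeff-1/q^-1 (suc m) (Fproduct (suc m) k) z e) ⟩
    -1ℤ ℤ.* -1ℤ ℤ.^ k ℤ.*
      (coeff* (Fproduct (suc m) k) (e ℤ.+ + suc m) ℤ.- coeff* (Fproduct (suc m) k) e)
      ≡⟨ lemma (-1ℤ ℤ.^ k) _ _ ⟩
    -1ℤ ℤ.^ k ℤ.* coeff* (Fproduct (suc m) k) e ℤ.-
      -1ℤ ℤ.^ k ℤ.* coeff* (Fproduct (suc m) k) (e ℤ.+ + suc m)
      ≡⟨ cong₂ ℤ._-_ (coeff-constᴸ (-1ℤ ℤ.^ k) (Fproduct (suc m) k) z e)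
                     (coeff-constᴸ (-1ℤ ℤ.^ k) (Fproduct (suc m) k) z (e ℤ.+ + suc m)) ⟨
    coeff* (Fterm (suc m) k) e ℤ.- coeff* (Fterm (suc m) k) (e ℤ.+ + suc m) ∎
    where
    lemma : ∀ c x y → -1ℤ ℤ.* c ℤ.* (x ℤ.- y) ≡ c ℤ.* y ℤ.- c ℤ.* x
    lemma = solve-∀

  coeff-sumᴸ-difference : ∀ (f g : ℕ → Laurent) d →
    (∀ k e → coeff* (f k) e ≡ coeff* (g k) e ℤ.- coeff* (g k) (e ℤ.+ d)) →
    ∀ N e → coeff* (sumᴸ (applyUpTo f N)) e ≡
            coeff* (sumᴸ (applyUpTo g N)) e ℤ.- coeff* (sumᴸ (applyUpTo g N)) (e ℤ.+ d)
  coeff-sumᴸ-difference f g d eq zero    e =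
    trans (coeff-0ᴸ-*ᴸ z e) (cong₂ ℤ._-_ (sym (coeff-0ᴸ-*ᴸ z e)) (sym (coeff-0ᴸ-*ᴸ z (e ℤ.+ d))))
  coeff-sumᴸ-difference f g d eq (suc N) e = begin
    coeff* (f 0 +ᴸ Σf) e              ≡⟨ coeff-+ᴸ-*ᴸ (f 0) Σf z e ⟩
    coeff* (f 0) e ℤ.+ coeff* Σf e
      ≡⟨ cong₂ ℤ._+_ (eq 0 e) (coeff-sumᴸ-difference (f ∘ suc) (g ∘ suc) d (eq ∘ suc) N e) ⟩
    (coeff* (g 0) e ℤ.- coeff* (g 0) (e ℤ.+ d)) ℤ.+ (coeff* Σg e ℤ.- coeff* Σg (e ℤ.+ d))
      ≡⟨ +-−-interchange (coeff* (g 0) e) _ _ _ ⟩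
    (coeff* (g 0) e ℤ.+ coeff* Σg e) ℤ.- (coeff* (g 0) (e ℤ.+ d) ℤ.+ coeff* Σg (e ℤ.+ d))
      ≡⟨ cong₂ ℤ._-_ (coeff-+ᴸ-*ᴸ (g 0) Σg z e) (coeff-+ᴸ-*ᴸ (g 0) Σg z (e ℤ.+ d)) ⟨
    coeff* (g 0 +ᴸ Σg) e ℤ.- coeff* (g 0 +ᴸ Σg) (e ℤ.+ d) ∎
    where
    Σf = sumᴸ (applyUpTo (f ∘ suc) N)
    Σg = sumᴸ (applyUpTo (g ∘ suc) N)

  -- With the leading 1 as summand k = 0, the sum for F_(m+1) matches index for index the sum over k
  -- ≥ 1 in F_(m+2).
  coeff-F-sum : ∀ m e → coeff* (F (suc m)) e ≡ coeff* (sumᴸ (applyUpTo (Fterm (suc m)) (suc m))) e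
  coeff-F-sum m e = begin
    coeff* (1ᴸ +ᴸ rest) e                    ≡⟨ coeff-+ᴸ-*ᴸ 1ᴸ rest z e ⟩
    coeff* 1ᴸ e ℤ.+ coeff* rest e
      ≡⟨ cong (λ x → x ℤ.+ coeff* rest e) (trans (coeff-constᴸ 1ℤ 1ᴸ z e)
         (ℤₚ.*-identityˡ (coeff* 1ᴸ e))) ⟨
    coeff* (Fterm (suc m) 0) e ℤ.+ coeff* rest e ≡⟨ coeff-+ᴸ-*ᴸ (Fterm (suc m) 0) rest z e ⟨
    coeff* (Fterm (suc m) 0 +ᴸ rest) e ∎
    where rest = sumᴸ (applyUpTo (Fterm (suc m) ∘ suc) m)

  -- All summands of F_(m+2) with k ≥ 1 share the factor -(q^(-(m+1)) - 1), and what remains is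
  -- F_(m+1).
  coeff-F-suc : ∀ m e → coeff* (F (suc (suc m))) e ≡
                coeff z e ℤ.+ (coeff* (F (suc m)) e ℤ.- coeff* (F (suc m)) (e ℤ.+ + suc m))
  coeff-F-suc m e = begin
    coeff* (F (suc (suc m))) e
      ≡⟨ coeff-+ᴸ-*ᴸ 1ᴸ (sumᴸ (applyUpTo (Fterm (suc (suc m)) ∘ suc) (suc m))) z e ⟩
    coeff* 1ᴸ e ℤ.+ coeff* (sumᴸ (applyUpTo (Fterm (suc (suc m)) ∘ suc) (suc m))) e
      ≡⟨ cong₂ ℤ._+_ (coeff-1ᴸ-*ᴸ z e) (coeff-sumᴸ-difference (Fterm (suc (suc m)) ∘ suc)
         (Fterm (suc m)) (+ suc m) (coeff-Fterm-suc m) (suc m) e) ⟩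
    coeff z e ℤ.+
      (coeff* (sumᴸ (applyUpTo (Fterm (suc m)) (suc m))) e ℤ.-
       coeff* (sumᴸ (applyUpTo (Fterm (suc m)) (suc m))) (e ℤ.+ + suc m))
      ≡⟨ cong₂ (λ x y → coeff z e ℤ.+ (x ℤ.- y)) (coeff-F-sum m e) (coeff-F-sum m (e ℤ.+ + suc m)) ⟨
    coeff z e ℤ.+ (coeff* (F (suc m)) e ℤ.- coeff* (F (suc m)) (e ℤ.+ + suc m)) ∎

-- Terms with nonpositive exponent

coeff-nonPositivePart-≤ : ∀ x e → e ℤ.≤ 0ℤ → coeff (nonPositivePart x) e ≡ coeff x e
coeff-nonPositivePart-≤ (f /q^ s) e e≤0 = begin
  coeff (nonPositivePart (f /q^ s)) e   ≡⟨ coeff-extend _ s e ⟩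
  extend g (e ℤ.+ + s)                  ≡⟨ truncate (e ℤ.+ + s) (ℤₚ.+-monoˡ-≤ (+ s) e≤0) ⟩
  extend f (e ℤ.+ + s)                  ≡⟨ coeff-extend f s e ⟨
  coeff (f /q^ s) e                     ∎
  where
  g = numerator (nonPositivePart (f /q^ s))
  truncate : ∀ i → i ℤ.≤ + s → extend g i ≡ extend f i
  truncate (+ n)    (ℤ.+≤+ n≤s) = cong (λ b → if b then f n else 0ℤ) (Equivalence.to T-≡ (≤⇒≤ᵇ n≤s))
  truncate -[1+ _ ] _           = refl

coeff-nonPositivePart-suc : ∀ x n → coeff (nonPositivePart x) (+ suc n) ≡ 0ℤ
coeff-nonPositivePart-suc (f /q^ s) n with suc n + s ≤ᵇ s in eq
... | true  = contradiction (≤ᵇ⇒≤ _ _ (Equivalence.from T-≡ eq)) (<⇒≱ (s≤s (m≤n+m s n)))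
... | false = refl

-- Subtracting the nonpositive part cancels every coefficient at exponents at most 0 and changes
-- none at positive ones.
positivePart-unique : ∀ f x → f 0 ≡ 0ℤ → (∀ n → f (suc n) ≡ coeff x (+ suc n)) →
  fromPowerSeries f ≈ x -ᴸ nonPositivePart x
positivePart-unique f x f₀ f₊ e = trans (eq e) (sym (coeff--ᴸ x (nonPositivePart x) e))
  where
  vanish : ∀ e → e ℤ.≤ 0ℤ → 0ℤ ≡ coeff x e ℤ.- coeff (nonPositivePart x) e
  vanish e e≤0 = sym (trans (cong (λ y → coeff x e ℤ.- y) (coeff-nonPositivePart-≤ x e e≤0))
    (ℤₚ.+-inverseʳ (coeff x e)))
  eq : ∀ e → coeff (fromPowerSeries f) e ≡ coeff x e ℤ.- coeff (nonPositivePart x) e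
  eq (+ zero)  = trans f₀ (vanish 0ℤ ℤₚ.≤-refl)
  eq (+ suc n) = begin
    f (suc n + 0)                   ≡⟨ cong f (+-identityʳ (suc n)) ⟩
    f (suc n)                       ≡⟨ f₊ n ⟩
    coeff x (+ suc n)               ≡⟨ ℤₚ.+-identityʳ _ ⟨
    coeff x (+ suc n) ℤ.- 0ℤ
      ≡⟨ cong (λ y → coeff x (+ suc n) ℤ.- y) (coeff-nonPositivePart-suc x n) ⟨
    coeff x (+ suc n) ℤ.- coeff (nonPositivePart x) (+ suc n) ∎
  eq -[1+ n ] = vanish -[1+ n ] ℤ.-≤+

-- Partitions

private variable
  ℓ p q r : Level
  X Y : Set ℓ
  n k m s : ℕ
  xs : List ℕ

-- Counting in finite lists

count : {P : Pred X p} → Decidable P → List X → ℕ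
count P? = length ∘ filter P?

module _ {P : Pred X p} {Q : Pred X q} {R : Pred X r}
         (P? : Decidable P) (Q? : Decidable Q) (R? : Decidable R) where

  count-⊎ : ∀ xs → (∀ {x} → x ∈ xs → P x → Q x ⊎ R x) → (∀ {x} → x ∈ xs → Q x → P x) →
            (∀ {x} → x ∈ xs → R x → P x) → (∀ {x} → x ∈ xs → Q x → ¬ R x) →
            count P? xs ≡ count Q? xs + count R? xs
  count-⊎ []       _    _    _    _        = refl
  count-⊎ (x ∷ xs) P⇒QR Q⇒P R⇒P disjoint
    with P? x | Q? x | R? x | count-⊎ xs (P⇒QR ∘ there) (Q⇒P ∘ there) (R⇒P ∘ there)
      (disjoint ∘ there)
  ... | _      | yes qx | yes rx | _  = contradiction rx (disjoint (here refl) qx)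
  ... | yes _  | yes _  | no _   | ih = cong suc ih
  ... | yes _  | no _   | yes _  | ih = trans (cong suc ih) (sym (+-suc _ _))
  ... | no ¬px | yes qx | _      | _  = contradiction (Q⇒P (here refl) qx) ¬px
  ... | no ¬px | _      | yes rx | _  = contradiction (R⇒P (here refl) rx) ¬px
  ... | yes px | no ¬qx | no ¬rx | _  with P⇒QR (here refl) px
  ...   | inj₁ qx = contradiction qx ¬qx
  ...   | inj₂ rx = contradiction rx ¬rx
  count-⊎ (x ∷ xs) _ _ _ _ | no _ | no _ | no _ | ih = ih

count-none : {P : Pred X p} (P? : Decidable P) → ∀ xs → (∀ {x} → x ∈ xs → ¬ P x) → count P? xs ≡ 0
count-none P? xs ¬P = cong length (filter-none P? (All.tabulate ¬P))

count-cong : {P : Pred X p} {Q : Pred X q} (P? : Decidable P) (Q? : Decidable Q) → ∀ xs →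
             (∀ {x} → x ∈ xs → P x → Q x) → (∀ {x} → x ∈ xs → Q x → P x) → count P? xs ≡ count Q? xs
count-cong P? Q? []       _   _   = refl
count-cong P? Q? (x ∷ xs) P⇒Q Q⇒P with P? x | Q? x | count-cong P? Q? xs (P⇒Q ∘ there) (Q⇒P ∘ there)
... | yes _  | yes _  | ih = cong suc ih
... | yes px | no ¬qx | _  = contradiction (P⇒Q (here refl) px) ¬qx
... | no ¬px | yes qx | _  = contradiction (Q⇒P (here refl) qx) ¬px
... | no _   | no _   | ih = ih

module _ {P : Pred X p} {Q : Pred Y q} (P? : Decidable P) (Q? : Decidable Q) (f : X → Y) where

  -- The image under `f` of one filtered list and the other filtered list have the same members and
  -- no duplicates, hence are permutations of each other.
  count-bijection : ∀ {xs ys} → Unique xs → Unique ys → (∀ {x y} → f x ≡ f y → x ≡ y) →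
                    (∀ {x} → x ∈ xs → P x → f x ∈ ys × Q (f x)) →
                    (∀ {y} → y ∈ ys → Q y → ∃ λ x → y ≡ f x × x ∈ xs × P x) →
                    count P? xs ≡ count Q? ys
  count-bijection {xs} {ys} xs! ys! f-inj to from =
    trans (sym (length-map f (filter P? xs)))
      (↭-length (∼bag⇒↭ (unique∧set⇒bag (Uniqueₚ.map⁺ f-inj (Uniqueₚ.filter⁺ P? xs!))
        (Uniqueₚ.filter⁺ Q? ys!)
        (mk⇔ to′ from′))))
    where
    to′ : ∀ {y} → y ∈ map f (filter P? xs) → y ∈ filter Q? ys
    to′ y∈ with x , x∈ , refl ← ∈-map⁻ f y∈
           with x∈xs , px ← ∈-filter⁻ P? x∈
           with fx∈ys , qfx ← to x∈xs px = ∈-filter⁺ Q? fx∈ys qfx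
    from′ : ∀ {y} → y ∈ filter Q? ys → y ∈ map f (filter P? xs)
    from′ y∈ with y∈ys , qy ← ∈-filter⁻ Q? y∈
             with x , refl , x∈ , px ← from y∈ys qy = ∈-map⁺ f (∈-filter⁺ P? x∈ px)

-- Multiplicities and the last part of a decreasing list

multiplicity-∷ʳ : ∀ s xs → multiplicity s (xs ∷ʳ s) ≡ suc (multiplicity s xs)
multiplicity-∷ʳ s xs = begin
  length (filter (s ≟_) (xs ∷ʳ s))
    ≡⟨ cong length (filter-++ (s ≟_) xs [ s ]) ⟩
  length (filter (s ≟_) xs ++ filter (s ≟_) [ s ])
    ≡⟨ cong (λ ys → length (filter (s ≟_) xs ++ ys)) (filter-accept (s ≟_) refl) ⟩
  length (filter (s ≟_) xs ∷ʳ s)                            ≡⟨ length-++ (filter (s ≟_) xs) ⟩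
  multiplicity s xs + 1                                     ≡⟨ +-comm _ 1 ⟩
  suc (multiplicity s xs)                                   ∎

∈⇒multiplicity>0 : s ∈ xs → 1 ≤ multiplicity s xs
∈⇒multiplicity>0 {s} = filter-some (s ≟_)

multiplicity>0⇒∈ : 1 ≤ multiplicity s xs → s ∈ xs
multiplicity>0⇒∈ {s} {xs} 1≤ with Any.any? (s ≟_) xs
... | yes s∈ = s∈
... | no  s∉ with () ← subst (1 ≤_) (cong length (filter-none (s ≟_) (¬Any⇒All¬ xs s∉))) 1≤

Linked-∷ʳ⁺ : Linked _≥_ xs → All (s ≤_) xs → Linked _≥_ (xs ∷ʳ s)
Linked-∷ʳ⁺ []          []         = [-]
Linked-∷ʳ⁺ [-]         (p ∷ [])   = p ∷ [-]
Linked-∷ʳ⁺ (x≥y ∷ xs≥) (_ ∷ s≤xs) = x≥y ∷ Linked-∷ʳ⁺ xs≥ s≤xs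

Linked-∷ʳ⁻ : ∀ xs → Linked _≥_ (xs ∷ʳ s) → Linked _≥_ xs
Linked-∷ʳ⁻ []           _           = []
Linked-∷ʳ⁻ (x ∷ [])     _           = [-]
Linked-∷ʳ⁻ (x ∷ y ∷ xs) (x≥y ∷ xs≥) = x≥y ∷ Linked-∷ʳ⁻ (y ∷ xs) xs≥

smallest∈tail : ∀ {x y zs} → x ≥ y → All (s ≤_) (y ∷ zs) → s ∈ x ∷ y ∷ zs → s ∈ y ∷ zs
smallest∈tail s≥y (s≤y ∷ _) (here refl) = here (≤-antisym s≤y s≥y)
smallest∈tail _   _         (there s∈)  = s∈

-- An occurrence of the smallest part can be pushed to the end, as equal parts follow it; this
-- supplies the inverse of appending s.
smallest-is-last : Linked _≥_ xs → All (s ≤_) xs → s ∈ xs → ∃ λ ys → xs ≡ ys ∷ʳ s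
smallest-is-last [-]         _          (here refl) = [] , refl
smallest-is-last {x ∷ _} (x≥y ∷ xs≥) (_ ∷ s≤xs) s∈
  with ys , eq ← smallest-is-last xs≥ s≤xs (smallest∈tail x≥y s≤xs s∈) = x ∷ ys , cong (x ∷_) eq

sum-∷ʳ : ∀ xs s → sum (xs ∷ʳ s) ≡ sum xs + s
sum-∷ʳ xs s = trans (sum-++ xs [ s ]) (cong (λ z → sum xs + z) (+-identityʳ s))

All≤⇒≡[]⊎≤sum : All (k ≤_) xs → xs ≡ [] ⊎ k ≤ sum xs
All≤⇒≡[]⊎≤sum []                    = inj₁ refl
All≤⇒≡[]⊎≤sum {xs = x ∷ xs} (p ∷ _) = inj₂ (≤-trans p (m≤m+n x (sum xs)))

-- Partitions classified by their smallest part

Parts≥ : ℕ → List ℕ → Set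
Parts≥ s = All (s ≤_)

parts≥? : ∀ s xs → Dec (Parts≥ s xs)
parts≥? s = All.all? (s ≤?_)

-- For m ≥ 1 this says that s is the smallest part and occurs at least m times. For m = 0 the part s
-- may be absent, which gives the induction on m its start.
Parts≥Mult≥ : ℕ → ℕ → List ℕ → Set
Parts≥Mult≥ m s xs = Parts≥ s xs × m ≤ multiplicity s xs

parts≥Mult≥? : ∀ m s xs → Dec (Parts≥Mult≥ m s xs)
parts≥Mult≥? m s xs = parts≥? s xs ×-dec (m ≤? multiplicity s xs)

-- For m ≥ 1 this is the union of `Parts≥Mult≥ m s` over s ≥ k; k = 1 yields `a m`.
Parts≥Smallest≥ : ℕ → ℕ → List ℕ → Set
Parts≥Smallest≥ m k xs = Parts≥ k xs × SmallestPartOccurs≥ m xs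

parts≥Smallest≥? : ∀ m k xs → Dec (Parts≥Smallest≥ m k xs)
parts≥Smallest≥? m k xs = parts≥? k xs ×-dec smallestPartOccurs≥? m xs

-- The series P_s; `p≥ 1` is the generating function of p(n).
p≥ : ℕ → PowerSeries
p≥ s n = + count (parts≥? s) (partitions n)

p≥-mult p≥-smallest : ℕ → ℕ → PowerSeries
p≥-mult m s n = + count (parts≥Mult≥? m s) (partitions n)
p≥-smallest m k n = + count (parts≥Smallest≥? m k) (partitions n)

Parts≥-suc : Parts≥ k xs → k ∈ xs ⊎ Parts≥ (suc k) xs
Parts≥-suc []        = inj₂ []
Parts≥-suc (k≤x ∷ k≤xs) with m≤n⇒m<n∨m≡n k≤x
... | inj₂ refl = inj₁ (here refl)
... | inj₁ k<x with Parts≥-suc k≤xs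
...   | inj₁ k∈   = inj₁ (there k∈)
...   | inj₂ k<xs = inj₂ (k<x ∷ k<xs)

Parts>⇒multiplicity≯0 : Parts≥ (suc k) xs → ¬ 1 ≤ multiplicity k xs
Parts>⇒multiplicity≯0 k<xs 1≤mult = <-irrefl refl (All.lookup k<xs (multiplicity>0⇒∈ 1≤mult))

p≥-split : ∀ k n → p≥ k n ≡ p≥-mult 1 k n ℤ.+ p≥ (suc k) n
p≥-split k n = cong +_ (count-⊎ (parts≥? k) (parts≥Mult≥? 1 k) (parts≥? (suc k)) (partitions n)
  (λ _ → split) (λ _ → proj₁) (λ _ → All.map <⇒≤)
    (λ _ (_ , 1≤mult) k<xs → Parts>⇒multiplicity≯0 k<xs 1≤mult))
  where
  split : Parts≥ k xs → Parts≥Mult≥ 1 k xs ⊎ Parts≥ (suc k) xs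
  split k≤xs with Parts≥-suc k≤xs
  ... | inj₁ k∈   = inj₁ (k≤xs , ∈⇒multiplicity>0 k∈)
  ... | inj₂ k<xs = inj₂ k<xs

-- The classes are smallest part k and smallest part above k. The bound 1 ≤ m makes k occur, which
-- keeps them disjoint.
p≥-smallest-split : ∀ m k n → 1 ≤ m → p≥-smallest m k n ≡ p≥-mult m k n ℤ.+ p≥-smallest m (suc k) n
p≥-smallest-split m k n 1≤m = cong +_ (count-⊎ (parts≥Smallest≥? m k) (parts≥Mult≥? m k)
  (parts≥Smallest≥? m (suc k)) (partitions n)
  (λ _ → split) (λ _ → smallest) (λ _ (k<xs , small) → All.map <⇒≤ k<xs , small)
  (λ _ (_ , m≤mult) (k<xs , _) → Parts>⇒multiplicity≯0 k<xs (≤-trans 1≤m m≤mult)))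
  where
  smallest : Parts≥Mult≥ m k xs → Parts≥Smallest≥ m k xs
  smallest (k≤xs , m≤mult) =
    k≤xs , Any.map (λ { refl → k≤xs , m≤mult }) (multiplicity>0⇒∈ (≤-trans 1≤m m≤mult))
  split : Parts≥Smallest≥ m k xs → Parts≥Mult≥ m k xs ⊎ Parts≥Smallest≥ m (suc k) xs
  split (k≤xs , small) with find small
  ... | s , s∈ , s≤xs , m≤mult with m≤n⇒m<n∨m≡n (All.lookup k≤xs s∈)
  ...   | inj₁ k<s  = inj₂ (All.map (<-≤-trans k<s) s≤xs , small)
  ...   | inj₂ refl = inj₁ (k≤xs , m≤mult)

p≥-mult-zero : ∀ s → p≥-mult 0 s ≐ p≥ s
p≥-mult-zero s n = cong +_ (count-cong (parts≥Mult≥? 0 s) (parts≥? s) (partitions n) (λ _ → proj₁)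
  (λ _ s≤xs → s≤xs , z≤n))

-- The bijection deletes the last part, which is the smallest one.
p≥-mult-suc : ∀ m s → 1 ≤ s → p≥-mult (suc m) s ≐ p≥-mult m s ·q^ s
p≥-mult-suc m s 1≤s n with n <? s
... | yes n<s = trans (cong +_ (count-none (parts≥Mult≥? (suc m) s) (partitions n) none))
  (sym (·q^-coeff-< (p≥-mult m s) n<s))
  where
  none : xs ∈ partitions n → ¬ Parts≥Mult≥ (suc m) s xs
  none xs∈ (s≤xs , m<mult) with All≤⇒≡[]⊎≤sum s≤xs
  ... | inj₁ refl with () ← m<mult
  ... | inj₂ s≤sum = <⇒≱ n<s (subst (s ≤_) (proj₂ (proj₂ (∈-partitions⁻ xs∈))) s≤sum)
... | no n≮s = subst (λ N → p≥-mult (suc m) s N ≡ (p≥-mult m s ·q^ s) N) (m+[n∸m]≡n (≮⇒≥ n≮s))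
  (trans (sym (cong +_ bijection)) (sym (·q^-coeff (p≥-mult m s) s d)))
  where
  d = n ∸ s
  bijection : count (parts≥Mult≥? m s) (partitions d) ≡
              count (parts≥Mult≥? (suc m) s) (partitions (s + d))
  bijection = count-bijection (parts≥Mult≥? m s) (parts≥Mult≥? (suc m) s) (_∷ʳ s)
    (partitions-unique d) (partitions-unique (s + d)) (∷ʳ-injectiveˡ _ _) append remove
    where
    append : xs ∈ partitions d → Parts≥Mult≥ m s xs →
             xs ∷ʳ s ∈ partitions (s + d) × Parts≥Mult≥ (suc m) s (xs ∷ʳ s)
    append {xs} xs∈ (s≤xs , m≤mult) with xs≥ , pos , sum≡ ← ∈-partitions⁻ xs∈ =
      ∈-partitions⁺ (Linked-∷ʳ⁺ xs≥ s≤xs , Allₚ.∷ʳ⁺ pos 1≤s ,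
                     trans (sum-∷ʳ xs s) (trans (cong (_+ s) sum≡) (+-comm d s))) ,
      Allₚ.∷ʳ⁺ s≤xs ≤-refl , subst (suc m ≤_) (sym (multiplicity-∷ʳ s xs)) (s≤s m≤mult)
    remove : ∀ {ys} → ys ∈ partitions (s + d) → Parts≥Mult≥ (suc m) s ys →
             ∃ λ xs → ys ≡ xs ∷ʳ s × xs ∈ partitions d × Parts≥Mult≥ m s xs
    remove ys∈ (s≤ys , m<mult)
      with ys≥ , pos , sum≡ ← ∈-partitions⁻ ys∈
      with xs , refl ← smallest-is-last ys≥ s≤ys (multiplicity>0⇒∈ (≤-trans (s≤s z≤n) m<mult)) =
      xs , refl ,
      ∈-partitions⁺ (Linked-∷ʳ⁻ xs ys≥ , proj₁ (Allₚ.∷ʳ⁻ pos) ,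
                     +-cancelʳ-≡ s (sum xs) d (trans (sym (sum-∷ʳ xs s))
                       (trans sum≡ (+-comm s d)))) ,
      proj₁ (Allₚ.∷ʳ⁻ s≤ys) , ≤-pred (subst (suc m ≤_) (multiplicity-∷ʳ s xs) m<mult)

p≥-mult≐p≥·q^ : ∀ m s → 1 ≤ s → p≥-mult m s ≐ p≥ s ·q^ (m * s)
p≥-mult≐p≥·q^ zero    s 1≤s   = p≥-mult-zero s
p≥-mult≐p≥·q^ (suc m) s 1≤s n = begin
  p≥-mult (suc m) s n                   ≡⟨ p≥-mult-suc m s 1≤s n ⟩
  (p≥-mult m s ·q^ s) n                 ≡⟨ ·q^-cong s (p≥-mult≐p≥·q^ m s 1≤s) n ⟩
  ((p≥ s ·q^ (m * s)) ·q^ s) n     ≡⟨ ·q^-·q^ (p≥ s) (m * s) s n ⟩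
  (p≥ s ·q^ (s + m * s)) n         ∎

p≥-suc : ∀ s → 1 ≤ s → p≥ s ≐ p≥ (suc s) +ˢ p≥ s ·q^ s
p≥-suc s 1≤s n = begin
  p≥ s n                                      ≡⟨ p≥-split s n ⟩
  p≥-mult 1 s n ℤ.+ p≥ (suc s) n                    ≡⟨ ℤₚ.+-comm (p≥-mult 1 s n) (p≥ (suc s) n) ⟩
  p≥ (suc s) n ℤ.+ p≥-mult 1 s n
    ≡⟨ cong (λ x → p≥ (suc s) n ℤ.+ x) (p≥-mult-suc 0 s 1≤s n) ⟩
  p≥ (suc s) n ℤ.+ (p≥-mult 0 s ·q^ s) n
    ≡⟨ cong (λ x → p≥ (suc s) n ℤ.+ x) (·q^-cong s (p≥-mult-zero s) n) ⟩
  p≥ (suc s) n ℤ.+ (p≥ s ·q^ s) n              ∎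

p≥-order : ∀ s n → n < s → p≥ s n ≡ 1ˢ n
p≥-order s zero    _   = refl
p≥-order s (suc n) n<s = cong +_ (count-none (parts≥? s) (partitions (suc n)) none)
  where
  none : xs ∈ partitions (suc n) → ¬ Parts≥ s xs
  none xs∈ s≤xs with _ , _ , sum≡ ← ∈-partitions⁻ {suc n} xs∈ with All≤⇒≡[]⊎≤sum s≤xs
  ... | inj₁ refl with () ← sum≡
  ... | inj₂ s≤sum = <⇒≱ n<s (subst (s ≤_) sum≡ s≤sum)

-- The empty partition has no smallest part, so the value is 0 even at n = 0, in contrast to
-- `p≥-order`. This starts the downward inductions on k.
p≥-smallest-order : ∀ m k n → n < k → p≥-smallest m k n ≡ 0ℤ
p≥-smallest-order m k n n<k = cong +_ (count-none (parts≥Smallest≥? m k) (partitions n) none)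
  where
  none : xs ∈ partitions n → ¬ Parts≥Smallest≥ m k xs
  none xs∈ (k≤xs , small) with _ , _ , sum≡ ← ∈-partitions⁻ {n} xs∈ with All≤⇒≡[]⊎≤sum k≤xs
  ... | inj₁ refl with () ← small
  ... | inj₂ k≤sum = <⇒≱ n<k (subst (k ≤_) sum≡ k≤sum)

a≡p≥-smallest : ∀ m n → + a m n ≡ p≥-smallest m 1 n
a≡p≥-smallest m n = cong +_ (count-cong (smallestPartOccurs≥? m) (parts≥Smallest≥? m 1)
  (partitions n)
  (λ xs∈ small → proj₁ (proj₂ (∈-partitions⁻ {n} xs∈)) , small) (λ _ → proj₂))

-- The recurrence in m for the partition counts

-- Once q^m is removed from the first series, both carry q^(mk), and P_(k+1) + q^k P_k = P_k.
-- Bijectively, for m ≥ 1, lowering m copies of k + 1 to k produces the partitions whose smallest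
-- part k occurs exactly m times.
p≥-mult-shift : ∀ m k n → 1 ≤ k → p≥-mult m (suc k) (m + n) ℤ.+ p≥-mult (suc m) k n ≡ p≥-mult m k n
p≥-mult-shift m k n 1≤k = begin
  p≥-mult m (suc k) (m + n) ℤ.+ p≥-mult (suc m) k n
    ≡⟨ cong₂ ℤ._+_ lhs rhs ⟩
  (p≥ (suc k) ·q^ (m * k)) n ℤ.+ ((p≥ k ·q^ k) ·q^ (m * k)) n
    ≡⟨ ·q^-+ˢ (p≥ (suc k)) (p≥ k ·q^ k) (m * k) n ⟨
  ((p≥ (suc k) +ˢ p≥ k ·q^ k) ·q^ (m * k)) n
    ≡⟨ ·q^-cong (m * k) (p≥-suc k 1≤k) n ⟨
  (p≥ k ·q^ (m * k)) n
    ≡⟨ p≥-mult≐p≥·q^ m k 1≤k n ⟨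
  p≥-mult m k n ∎
  where
  lhs : p≥-mult m (suc k) (m + n) ≡ (p≥ (suc k) ·q^ (m * k)) n
  lhs = begin
    p≥-mult m (suc k) (m + n)
      ≡⟨ p≥-mult≐p≥·q^ m (suc k) (s≤s z≤n) (m + n) ⟩
    (p≥ (suc k) ·q^ (m * suc k)) (m + n)
      ≡⟨ cong (λ e → (p≥ (suc k) ·q^ e) (m + n)) (*-suc m k) ⟩
    (p≥ (suc k) ·q^ (m + m * k)) (m + n)           ≡⟨ ·q^-·q^ (p≥ (suc k)) (m * k) m (m + n) ⟨
    ((p≥ (suc k) ·q^ (m * k)) ·q^ m) (m + n)       ≡⟨ ·q^-coeff _ m n ⟩
    (p≥ (suc k) ·q^ (m * k)) n                     ∎
  rhs : p≥-mult (suc m) k n ≡ ((p≥ k ·q^ k) ·q^ (m * k)) n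
  rhs = begin
    p≥-mult (suc m) k n                       ≡⟨ p≥-mult≐p≥·q^ (suc m) k 1≤k n ⟩
    (p≥ k ·q^ (k + m * k)) n             ≡⟨ cong (λ e → (p≥ k ·q^ e) n) (+-comm k (m * k)) ⟩
    (p≥ k ·q^ (m * k + k)) n             ≡⟨ ·q^-·q^ (p≥ k) k (m * k) n ⟨
    ((p≥ k ·q^ k) ·q^ (m * k)) n         ∎

-- This is `p≥-mult-shift` summed over all smallest parts from k on.
p≥-smallest-shift : ∀ m k n → 1 ≤ m → 1 ≤ k →
  p≥-smallest m (suc k) (m + n) ℤ.+ p≥-smallest (suc m) k n ≡ p≥-smallest m k n
-- After `suc (m + n)` steps upward from k, the smallest part exceeds m + n and all counts vanish.
p≥-smallest-shift m k n 1≤m = downward (suc (m + n)) k (m≤m+n (suc (m + n)) k)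
  where
  downward : ∀ d k → m + n < d + k → 1 ≤ k →
    p≥-smallest m (suc k) (m + n) ℤ.+ p≥-smallest (suc m) k n ≡ p≥-smallest m k n
  downward zero    k m+n<k _   = begin
    p≥-smallest m (suc k) (m + n) ℤ.+ p≥-smallest (suc m) k n
      ≡⟨ cong₂ ℤ._+_ (p≥-smallest-order m (suc k) (m + n) (m≤n⇒m≤1+n m+n<k))
         (p≥-smallest-order (suc m) k n n<k) ⟩
    0ℤ              ≡⟨ p≥-smallest-order m k n n<k ⟨
    p≥-smallest m k n         ∎
    where n<k = ≤-<-trans (m≤n+m n m) m+n<k
  downward (suc d) k m+n<d+k 1≤k = begin
    p≥-smallest m (suc k) (m + n) ℤ.+ p≥-smallest (suc m) k n
      ≡⟨ cong₂ ℤ._+_ (p≥-smallest-split m (suc k) (m + n) 1≤m)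
         (p≥-smallest-split (suc m) k n (s≤s z≤n)) ⟩
    (p≥-mult m (suc k) (m + n) ℤ.+ p≥-smallest m (suc (suc k)) (m + n))
      ℤ.+ (p≥-mult (suc m) k n ℤ.+ p≥-smallest (suc m) (suc k) n)
      ≡⟨ +-interchange (p≥-mult m (suc k) (m + n)) (p≥-smallest m (suc (suc k)) (m + n))
         (p≥-mult (suc m) k n) (p≥-smallest (suc m) (suc k) n) ⟩
    (p≥-mult m (suc k) (m + n) ℤ.+ p≥-mult (suc m) k n)
      ℤ.+ (p≥-smallest m (suc (suc k)) (m + n) ℤ.+ p≥-smallest (suc m) (suc k) n)
      ≡⟨ cong₂ ℤ._+_ (p≥-mult-shift m k n 1≤k)
         (downward d (suc k) (subst (m + n <_) (sym (+-suc d k)) m+n<d+k) (s≤s z≤n)) ⟩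
    p≥-mult m k n ℤ.+ p≥-smallest m (suc k) n
      ≡⟨ p≥-smallest-split m k n 1≤m ⟨
    p≥-smallest m k n ∎

-- Smallest part 1 is treated apart: deleting m ones gives every partition of n, whence `p≥ 1 n`.
-- Larger smallest parts fall under `p≥-smallest-shift` at k = 1.
a-shift : ∀ m n → 1 ≤ m → + a m (m + n) ℤ.+ + a (suc m) n ≡ p≥ 1 n ℤ.+ + a m n
a-shift m n 1≤m = begin
  + a m (m + n) ℤ.+ + a (suc m) n
    ≡⟨ cong₂ ℤ._+_ (trans (a≡p≥-smallest m (m + n)) (p≥-smallest-split m 1 (m + n) 1≤m))
       (a≡p≥-smallest (suc m) n) ⟩
  (p≥-mult m 1 (m + n) ℤ.+ p≥-smallest m 2 (m + n)) ℤ.+ p≥-smallest (suc m) 1 n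
    ≡⟨ ℤₚ.+-assoc (p≥-mult m 1 (m + n)) (p≥-smallest m 2 (m + n)) (p≥-smallest (suc m) 1 n) ⟩
  p≥-mult m 1 (m + n) ℤ.+ (p≥-smallest m 2 (m + n) ℤ.+ p≥-smallest (suc m) 1 n)
    ≡⟨ cong₂ ℤ._+_ without-1s (trans (p≥-smallest-shift m 1 n 1≤m ≤-refl)
       (sym (a≡p≥-smallest m n))) ⟩
  p≥ 1 n ℤ.+ + a m n ∎
  where
  without-1s : p≥-mult m 1 (m + n) ≡ p≥ 1 n
  without-1s = begin
    p≥-mult m 1 (m + n)                   ≡⟨ p≥-mult≐p≥·q^ m 1 ≤-refl (m + n) ⟩
    (p≥ 1 ·q^ (m * 1)) (m + n)       ≡⟨ cong (λ e → (p≥ 1 ·q^ e) (m + n)) (*-identityʳ m) ⟩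
    (p≥ 1 ·q^ m) (m + n)             ≡⟨ ·q^-coeff (p≥ 1) m n ⟩
    p≥ 1 n                           ∎

-- A nonempty partition has a smallest part, which occurs at least once; `suc n` excludes the empty
-- one. Formally, both sides split off smallest part k alike and vanish for large k.
p≥-smallest-1 : ∀ k n → p≥-smallest 1 k (suc n) ≡ p≥ k (suc n)
p≥-smallest-1 k n = downward (suc (suc n)) k (m≤m+n (suc (suc n)) k)
  where
  downward : ∀ d k → suc n < d + k → p≥-smallest 1 k (suc n) ≡ p≥ k (suc n)
  downward zero    k n<k   = trans (p≥-smallest-order 1 k (suc n) n<k)
    (sym (p≥-order k (suc n) n<k))
  downward (suc d) k n<d+k = begin
    p≥-smallest 1 k (suc n)                              ≡⟨ p≥-smallest-split 1 k (suc n) ≤-refl ⟩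
    p≥-mult 1 k (suc n) ℤ.+ p≥-smallest 1 (suc k) (suc n)
      ≡⟨ cong (λ x → p≥-mult 1 k (suc n) ℤ.+ x)
         (downward d (suc k) (subst (suc n <_) (sym (+-suc d k)) n<d+k)) ⟩
    p≥-mult 1 k (suc n) ℤ.+ p≥ (suc k) (suc n)        ≡⟨ p≥-split k (suc n) ⟨
    p≥ k (suc n)                                ∎

-- Coefficients of F_m/(q;q)_∞

coeff-1/qq∞ : ∀ n → coeff 1/qq∞ (+ n) ≡ p≥ 1 n
coeff-1/qq∞ n = begin
  recip (pochhammer∞ qˢ) refl (n + 0)
    ≡⟨ 1/pochhammer∞ p≥ (λ s → p≥-suc (suc s) (s≤s z≤n)) p≥-order (n + 0) ⟩
  p≥ 1 (n + 0)                           ≡⟨ cong (p≥ 1) (+-identityʳ n) ⟩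
  p≥ 1 n                                 ∎

-- Induction on m: `coeff-F-suc` is `a-shift` solved for its term in m + 1. The base case F_1 = 1 is
-- a_1(n) = p(n) for n ≥ 1.
coeff-F-1/qq∞ : ∀ m n → coeff (F (suc m) *ᴸ 1/qq∞) (+ suc n) ≡ + a (suc m) (suc n)
coeff-F-1/qq∞ zero n = begin
  coeff (F 1 *ᴸ 1/qq∞) (+ suc n)
    ≡⟨ coeff-+ᴸ-*ᴸ 1ᴸ 0ᴸ 1/qq∞ (+ suc n) ⟩
  coeff (1ᴸ *ᴸ 1/qq∞) (+ suc n) ℤ.+ coeff (0ᴸ *ᴸ 1/qq∞) (+ suc n)
    ≡⟨ cong₂ ℤ._+_ (coeff-1ᴸ-*ᴸ 1/qq∞ (+ suc n)) (coeff-0ᴸ-*ᴸ 1/qq∞ (+ suc n)) ⟩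
  coeff 1/qq∞ (+ suc n) ℤ.+ 0ℤ
    ≡⟨ ℤₚ.+-identityʳ _ ⟩
  coeff 1/qq∞ (+ suc n)
    ≡⟨ coeff-1/qq∞ (suc n) ⟩
  p≥ 1 (suc n)
    ≡⟨ p≥-smallest-1 1 n ⟨
  p≥-smallest 1 1 (suc n)
    ≡⟨ a≡p≥-smallest 1 (suc n) ⟨
  + a 1 (suc n) ∎
coeff-F-1/qq∞ (suc m) n = begin
  coeff (F (suc (suc m)) *ᴸ 1/qq∞) (+ suc n)
    ≡⟨ coeff-F-suc 1/qq∞ m (+ suc n) ⟩
  coeff 1/qq∞ (+ suc n) ℤ.+
    (coeff (F (suc m) *ᴸ 1/qq∞) (+ suc n) ℤ.- coeff (F (suc m) *ᴸ 1/qq∞) (+ suc (n + suc m)))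
    -- The induction hypothesis is used at two exponents; the shift by `suc m` keeps the second one
    -- positive.
    ≡⟨ cong₂ ℤ._+_ (coeff-1/qq∞ (suc n))
                   (cong₂ ℤ._-_ (coeff-F-1/qq∞ m n) (coeff-F-1/qq∞ m (n + suc m))) ⟩
  p≥ 1 (suc n) ℤ.+ (+ a (suc m) (suc n) ℤ.- + a (suc m) (suc n + suc m))
    ≡⟨ cong (λ N → p≥ 1 (suc n) ℤ.+ (+ a (suc m) (suc n) ℤ.- + a (suc m) N))
       (+-comm (suc n) (suc m)) ⟩
  p≥ 1 (suc n) ℤ.+ (+ a (suc m) (suc n) ℤ.- + a (suc m) (suc m + suc n))
    ≡⟨ solve-for (p≥ 1 (suc n)) (+ a (suc m) (suc n)) (+ a (suc m) (suc m + suc n)) _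
                 (a-shift (suc m) (suc n) (s≤s z≤n)) ⟩
  + a (suc (suc m)) (suc n) ∎
  where
  cancel : ∀ x y → (x ℤ.+ y) ℤ.- x ≡ y
  cancel = solve-∀
  solve-for : ∀ c d x y → x ℤ.+ y ≡ c ℤ.+ d → c ℤ.+ (d ℤ.- x) ≡ y
  solve-for c d x y eq = begin
    c ℤ.+ (d ℤ.- x)      ≡⟨ ℤₚ.+-assoc c d (ℤ.- x) ⟨
    (c ℤ.+ d) ℤ.- x      ≡⟨ cong (ℤ._- x) eq ⟨
    (x ℤ.+ y) ℤ.- x      ≡⟨ cancel x y ⟩
    y                    ∎

theorem3p3 : (m : ℕ) → 1 ≤ m →
             fromPowerSeries (∑a m) ≈ F m *ᴸ 1/qq∞ -ᴸ 𝒟 m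
theorem3p3 (suc m) _ =
  positivePart-unique (∑a (suc m)) (F (suc m) *ᴸ 1/qq∞) refl (λ n → sym (coeff-F-1/qq∞ m n))
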